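{- Let $\Delta$ be of type $A_n$ and let $\mathfrak{Ab}$ be its poset of abelian ideals. Then (i) $\mathcal K^{u}_{\mathfrak{Ab}}(q)=\sum_{k\ge0}\binom{n+1}{2k}q^k$; (ii) $\mathcal K^{l}_{\mathfrak{Ab}}(q)=\sum_{k\ge0}\big(\binom{n}{2k+1}+\binom{n}{2k-2}\big)q^k$; (iii) $D_{\mathfrak{Ab}}(q)=-\sum_{k\ge0}\binom{n-1}{2k+1}q^k$.
   Context: Type $A_n$: positive roots $\Delta^+=\{\varepsilon_i-\varepsilon_j:1\le i<j\le n+1\}$, simple roots $\varepsilon_i-\varepsilon_{i+1}$, with the root order (the partial order generated by $\gamma$ covering $\mu$ iff $\gamma-\mu$ is a simple root). An upper ideal $I\subset\Delta^+$ (up-closed subset) is abelian if $\gamma'+\gamma''\notin\Delta^+$ for all $\gamma',\gamma''\in I$; $\mathfrak{Ab}$ is the poset of all abelian upper ideals (including $\varnothing$) ordered by inclusion. For a finite poset $\mathcal P$, $\kappa(x)$ (resp. $\iota(x)$) is the number of elements covered by (resp. covering) $x$; $\mathcal K^{u}_{\mathcal P}=\sum_x q^{\kappa(x)}$, $\mathcal K^{l}_{\mathcal P}=\sum_x q^{\iota(x)}$, and $D_{\mathcal P}$ is defined by $\mathcal K^{u}_{\mathcal P}-\mathcal K^{l}_{\mathcal P}=(q-1)^2D_{\mathcal P}$. Binomial coefficients with negative lower index are $0$. -}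

module Defs where

open import Data.Bool using (Bool; true; false; if_then_else_)
open import Data.Nat using (ℕ; zero; suc; _+_; _*_)
open import Data.Nat.Combinatorics using (_C_)
open import Data.Integer as ℤ using (ℤ; +_)
open import Data.Fin as Fin using (Fin; inject₁)
open import Data.Vec using (Vec; lookup)
open import Data.List using (List; length)
open import Data.List.Relation.Unary.Unique.Propositional using (Unique)
open import Data.List.Membership.Propositional using (_∈_)
open import Data.Product using (Σ; _×_; _,_; proj₁; proj₂)
open import Relation.Nullary using (¬_; does)
open import Relation.Binary.PropositionalEquality using (_≡_; _≢_)
open import Relation.Binary.Construct.Closure.ReflexiveTransitive using (Star)
open import Function.Bundles using (_⇔_)

HasCard : {A : Set} → (A → Set) → ℕ → Set
HasCard {A} P c =
  Σ (List A) λ l → Unique l × (∀ x → P x ⇔ (x ∈ l)) × length l ≡ c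

-- Type A_n.  Indices 1..n+1 are represented by Fin (suc n).
-- Positive root ε_i - ε_j (i < j) is a pair (i , j) with proof i < j.

Root : ℕ → Set
Root n = Σ (Fin (suc n) × Fin (suc n)) λ p → proj₁ p Fin.< proj₂ p

ε : {n : ℕ} → Fin (suc n) → Fin (suc n) → ℤ
ε i k = if does (i Fin.≟ k) then + 1 else + 0

vec : {n : ℕ} → Root n → Fin (suc n) → ℤ
vec ((i , j) , _) k = ε i k ℤ.- ε j k

simple : {n : ℕ} → Fin n → Fin (suc n) → ℤ
simple a k = ε (inject₁ a) k ℤ.- ε (Fin.suc a) k

IsPosRoot : {n : ℕ} → (Fin (suc n) → ℤ) → Set
IsPosRoot {n} v = Σ (Root n) λ γ → ∀ k → vec γ k ≡ v k

_⋖ʳ_ : {n : ℕ} → Root n → Root n → Set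
_⋖ʳ_ {n} μ γ = Σ (Fin n) λ a → ∀ k → vec γ k ≡ vec μ k ℤ.+ simple a k

_≼_ : {n : ℕ} → Root n → Root n → Set
_≼_ = Star _⋖ʳ_

-- Subsets of Δ⁺: a Boolean (n+1)×(n+1) table, entry (i,j) meaning
-- "ε_i - ε_j ∈ I"; entries with ¬ (i < j) are required to be false.

RSet : ℕ → Set
RSet n = Vec (Vec Bool (suc n)) (suc n)

entry : {n : ℕ} → RSet n → Fin (suc n) → Fin (suc n) → Bool
entry I i j = lookup (lookup I i) j

_∈ʳ_ : {n : ℕ} → Root n → RSet n → Set
((i , j) , _) ∈ʳ I = entry I i j ≡ true

IsRootSubset : {n : ℕ} → RSet n → Set
IsRootSubset I = ∀ i j → entry I i j ≡ true → i Fin.< j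

IsUpperIdeal : {n : ℕ} → RSet n → Set
IsUpperIdeal I =
  IsRootSubset I × (∀ γ δ → γ ≼ δ → γ ∈ʳ I → δ ∈ʳ I)

IsAbelian : {n : ℕ} → RSet n → Set
IsAbelian I =
  ∀ γ δ → γ ∈ʳ I → δ ∈ʳ I → ¬ IsPosRoot (λ k → vec γ k ℤ.+ vec δ k)

InAb : {n : ℕ} → RSet n → Set
InAb I = IsUpperIdeal I × IsAbelian I

_⊆ʳ_ : {n : ℕ} → RSet n → RSet n → Set
I ⊆ʳ J = ∀ i j → entry I i j ≡ true → entry J i j ≡ true

_⊂ʳ_ : {n : ℕ} → RSet n → RSet n → Set
I ⊂ʳ J = I ⊆ʳ J × I ≢ J

_⋖Ab_ : {n : ℕ} → RSet n → RSet n → Set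
x ⋖Ab y = InAb x × InAb y × x ⊂ʳ y ×
          (∀ z → InAb z → x ⊂ʳ z → ¬ (z ⊂ʳ y))

-- Coefficients of the polynomials K^u and K^l of 𝔄𝔟.
-- KuCoeff n k c : the number of x ∈ 𝔄𝔟 with κ(x) = k is c,
--   where κ(x) = #{ y ∈ 𝔄𝔟 | x covers y }.
-- KlCoeff n k c : the number of x ∈ 𝔄𝔟 with ι(x) = k is c,
--   where ι(x) = #{ y ∈ 𝔄𝔟 | y covers x }.

KuCoeff : ℕ → ℕ → ℕ → Set
KuCoeff n k c =
  HasCard {RSet n} (λ x → InAb x × HasCard (λ y → y ⋖Ab x) k) c

KlCoeff : ℕ → ℕ → ℕ → Set
KlCoeff n k c =
  HasCard {RSet n} (λ x → InAb x × HasCard (λ y → x ⋖Ab y) k) c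

-- Polynomials in q as coefficient sequences ℕ → ℤ.

shift : (ℕ → ℤ) → ℕ → ℤ
shift f zero    = + 0
shift f (suc k) = f k

mulQm1sq : (ℕ → ℤ) → ℕ → ℤ
mulQm1sq d k = d k ℤ.- (+ 2) ℤ.* shift d k ℤ.+ shift (shift d) k

-- binom n (2k - 2), with binomials of negative lower index = 0
binom2km2 : ℕ → ℕ → ℕ
binom2km2 n zero    = 0
binom2km2 n (suc k) = n C (2 * k)

uRHS : ℕ → ℕ → ℕ
uRHS n k = suc n C (2 * k)

lRHS : ℕ → ℕ → ℕ
lRHS n k = n C (suc (2 * k)) + binom2km2 n k

-- D(q) = - Σ_k binom (n-1) (2k+1) q^k, for n = suc m
dRHS : ℕ → ℕ → ℤ
dRHS m k = ℤ.- (+ (m C suc (2 * k)))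

{-# OPTIONS --safe #-}
module Submission where

-- Encode the root ε_i − ε_j as the box in row i and column n + 2 − j: upper ideals become Young
-- diagrams, and a nonempty ideal is abelian iff the number of its rows plus the number of its
-- columns is at most n + 1.  Such diagrams correspond to their boundary paths, arbitrary words of
-- length n in two letters, and the covering relation adds a single box.  Removable boxes are
-- corners of the path; framed by a left step at both ends, a path with k corners has 2k turns at
-- n + 1 possible places, whence binom(n+1, 2k).  A diagram with k corners has k + 1 boxes that can
-- be added to it; all of them are admissible if the bound n + 1 is not attained, and all but the
-- two starting a new row or column if it is attained.  The first letter of the word tells which.

open import Defs
open import Data.Bool using (Bool; true; false; if_then_else_)
import Data.Bool.Properties as Bool
open import Data.Fin as Fin using (Fin; toℕ; opposite; fromℕ<; inject₁)
open import Data.Fin.Induction using (<-weakInduction-startingFrom)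
import Data.Fin.Properties as Fin
open import Data.Integer as ℤ using (ℤ; +_)
import Data.Integer.Tactic.RingSolver as ℤ-Solver
open import Data.List using (List; []; _∷_; length; _++_)
open import Data.List.Membership.Propositional using (_∈_)
open import Data.List.Membership.Propositional.Properties using (∈-++⁺ˡ; ∈-++⁺ʳ; ∈-++⁻; ∈-∃++)
open import Data.List.Membership.Propositional.Properties.WithK using (unique∧set⇒bag)
open import Data.List.Properties using (length-++)
open import Data.List.Relation.Binary.BagAndSetEquality using (∼bag⇒↭)
open import Data.List.Relation.Binary.Permutation.Propositional using (↭-sym; ↭⇒↭ₛ)
open import Data.List.Relation.Binary.Permutation.Propositional.Properties
  using (↭-length; ∈-resp-↭) renaming (shift to ↭-shift)
open import Data.List.Relation.Binary.Permutation.Setoid.Properties using (Unique-resp-↭)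
open import Data.List.Relation.Unary.All as All using (All; []; _∷_)
open import Data.List.Relation.Unary.AllPairs using ([]; _∷_)
open import Data.List.Relation.Unary.Any using (here; there)
open import Data.List.Relation.Unary.Unique.Propositional using (Unique)
import Data.List.Relation.Unary.Unique.Propositional.Properties as Unique
open import Data.Nat
open import Data.Nat.Combinatorics using (_C_; nCk+nC[k+1]≡[n+1]C[k+1]; k>n⇒nCk≡0)
open import Data.Nat.Properties
open import Data.Product using (∃-syntax; _×_; _,_; proj₁; proj₂)
open import Data.Sum using (_⊎_; inj₁; inj₂)
open import Data.Vec using (Vec; []; _∷_; tabulate; lookup)
import Data.Vec.Properties as Vec
open import Function using (_∘_; id; _⇔_; mk⇔; Equivalence)
open import Function.Properties.Equivalence using () renaming (trans to ⇔-trans; sym to ⇔-sym)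
open import Relation.Binary.Construct.Closure.ReflexiveTransitive using (_◅_) renaming (ε to done)
open import Relation.Binary.PropositionalEquality
open import Relation.Nullary using (¬_; Dec; does; yes; no; contradiction; _×-dec_)
open import Relation.Nullary.Decidable using (dec-true; dec-false)
open import Relation.Unary using (Decidable)

open Equivalence using (to; from)

-- Cardinalities

HasCard-resp-⇔ : {A : Set} {P Q : A → Set} {k : ℕ} →
                 (∀ x → P x ⇔ Q x) → HasCard P k → HasCard Q k
HasCard-resp-⇔ P⇔Q (l , uniq , P⇔∈ , len) =
  l , uniq , (λ x → ⇔-trans (⇔-sym (P⇔Q x)) (P⇔∈ x)) , len

-- Duplicate-free lists with the same members are permutations of each other. This makes the
-- coefficients of both polynomials well defined.
HasCard-unique : {A : Set} {P : A → Set} {j k : ℕ} →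
                 HasCard P j → HasCard P k → j ≡ k
HasCard-unique (_ , uniq , P⇔∈ , len) (_ , uniq′ , P⇔∈′ , len′) =
  trans (sym len) (trans (↭-length (∼bag⇒↭ (unique∧set⇒bag uniq uniq′
    (λ {x} → ⇔-trans (⇔-sym (P⇔∈ x)) (P⇔∈′ x))))) len′)

HasCard-∅ : {A : Set} {P : A → Set} → (∀ x → ¬ P x) → HasCard P 0
HasCard-∅ ¬P = [] , [] , (λ x → mk⇔ (λ p → contradiction p (¬P x)) (λ ())) , refl

HasCard-singleton : {A : Set} {P : A → Set} (a : A) → P a → (∀ x → P x → x ≡ a) →
                    HasCard P 1
HasCard-singleton a pa P⇒≡a =
  a ∷ [] , [] ∷ [] ,
  (λ x → mk⇔ (λ px → here (P⇒≡a x px)) λ { (here refl) → pa }) , refl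

-- The bijection is a relation rather than a function, because an image may be built only from a
-- proof of `P a`, as when a box is removed at a given row. `functional` makes the result
-- independent of the proof chosen.
module _ {A B : Set} {P : A → Set} {Q : B → Set} (R : A → B → Set)
         (image    : ∀ a → P a → ∃[ b ] Q b × R a b)
         (preimage : ∀ b → Q b → ∃[ a ] P a × R a b)
         (injective  : ∀ {a a′ b} → R a b → R a′ b → a ≡ a′)
         (functional : ∀ {a b b′} → R a b → R a b′ → b ≡ b′) where

  private
    images : ∀ l → All P l → List B
    images []      []       = []
    images (a ∷ l) (p ∷ ps) = proj₁ (image a p) ∷ images l ps

    length-images : ∀ l ps → length (images l ps) ≡ length l
    length-images []      []       = refl
    length-images (a ∷ l) (p ∷ ps) = cong suc (length-images l ps)

    ∈-images⁺ : ∀ {l a b} ps → a ∈ l → R a b → b ∈ images l ps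
    ∈-images⁺ (p ∷ ps) (here refl) r = here (functional r (proj₂ (proj₂ (image _ p))))
    ∈-images⁺ (p ∷ ps) (there a∈l) r = there (∈-images⁺ ps a∈l r)

    ∈-images⁻ : ∀ {l b} ps → b ∈ images l ps → ∃[ a ] a ∈ l × Q b × R a b
    ∈-images⁻ {a ∷ l} (p ∷ ps) (here refl) = a , here refl , proj₂ (image a p)
    ∈-images⁻ {a ∷ l} (p ∷ ps) (there b∈)  =
      let a′ , a′∈l , qr = ∈-images⁻ ps b∈ in a′ , there a′∈l , qr

    images-unique : ∀ {l} ps → Unique l → Unique (images l ps)
    images-unique []       []         = []
    images-unique (p ∷ ps) (a∉l ∷ ul) =
      All.tabulate (λ b∈ b≡ → let a′ , a′∈l , _ , r = ∈-images⁻ ps b∈ in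
        All.lookup a∉l a′∈l (injective (subst (R _) b≡ (proj₂ (proj₂ (image _ p)))) r))
      ∷ images-unique ps ul

  HasCard-transfer : ∀ {k} → HasCard P k → HasCard Q k
  HasCard-transfer (l , ul , P⇔∈ , len) =
    images l ps , images-unique ps ul ,
    (λ b → mk⇔ (λ q → let a , p , r = preimage b q in ∈-images⁺ ps (to (P⇔∈ a) p) r)
               (λ b∈ → proj₁ (proj₂ (proj₂ (∈-images⁻ ps b∈))))) ,
    trans (length-images l ps) len
    where
    ps : All P l
    ps = All.tabulate (λ {a} a∈l → from (P⇔∈ a) a∈l)

HasCard-⊎ : {A : Set} {P Q : A → Set} {j k : ℕ} → (∀ x → P x → ¬ Q x) →
            HasCard P j → HasCard Q k → HasCard (λ x → P x ⊎ Q x) (j + k)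
HasCard-⊎ {P = P} {Q} disjoint (l , ul , P⇔∈ , len) (l′ , ul′ , Q⇔∈ , len′) =
  l ++ l′ ,
  Unique.++⁺ ul ul′ (λ (x∈l , x∈l′) → disjoint _ (from (P⇔∈ _) x∈l) (from (Q⇔∈ _) x∈l′)) ,
  (λ x → mk⇔ (into x) (outof x)) ,
  trans (length-++ l) (cong₂ _+_ len len′)
  where
  into : ∀ x → P x ⊎ Q x → x ∈ l ++ l′
  into x (inj₁ p) = ∈-++⁺ˡ (to (P⇔∈ x) p)
  into x (inj₂ q) = ∈-++⁺ʳ l (to (Q⇔∈ x) q)
  outof : ∀ x → x ∈ l ++ l′ → P x ⊎ Q x
  outof x x∈ with ∈-++⁻ l x∈
  ... | inj₁ x∈l  = inj₁ (from (P⇔∈ x) x∈l)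
  ... | inj₂ x∈l′ = inj₂ (from (Q⇔∈ x) x∈l′)

HasCard-image : {A B : Set} {P : A → Set} {k : ℕ} (f : A → B) →
                (∀ {x y} → f x ≡ f y → x ≡ y) →
                HasCard P k → HasCard (λ b → ∃[ a ] b ≡ f a × P a) k
HasCard-image f inj = HasCard-transfer (λ a b → b ≡ f a)
  (λ a p → f a , (a , refl , p) , refl) (λ b (a , eq , p) → a , p , eq)
  (λ eq eq′ → inj (trans (sym eq) eq′)) (λ eq eq′ → trans eq (sym eq′))

HasCard-remove : {A : Set} {P : A → Set} {k : ℕ} (a : A) → P a → HasCard P (suc k) →
                 HasCard (λ x → P x × x ≢ a) k
HasCard-remove {P = P} a p (l , ul , P⇔∈ , len) with ∈-∃++ (to (P⇔∈ a) p)
... | xs , ys , refl with Unique-resp-↭ (setoid _) (↭⇒↭ₛ (↭-shift a xs ys)) ul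
... | a∉ ∷ uniq =
  xs ++ ys , uniq ,
  (λ x → mk⇔ (λ (px , x≢a) → strip x≢a (∈-resp-↭ (↭-shift a xs ys) (to (P⇔∈ x) px)))
             (λ x∈ → from (P⇔∈ x) (∈-resp-↭ (↭-sym (↭-shift a xs ys)) (there x∈)) ,
                     λ x≡a → All.lookup a∉ x∈ (sym x≡a))) ,
  suc-injective (trans (sym (↭-length (↭-shift a xs ys))) len)
  where
  strip : ∀ {x} {zs : List _} → x ≢ a → x ∈ a ∷ zs → x ∈ zs
  strip x≢a (here x≡a) = contradiction x≡a x≢a
  strip x≢a (there x∈) = x∈

HasCard-ℕ-suc : {P : ℕ → Set} {k : ℕ} → ¬ P 0 → HasCard (P ∘ suc) k → HasCard P k
HasCard-ℕ-suc ¬P0 = HasCard-transfer (λ a b → b ≡ suc a)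
  (λ a p → suc a , p , refl)
  (λ { zero p → contradiction p ¬P0 ; (suc b) p → b , p , refl })
  (λ eq eq′ → suc-injective (trans (sym eq) eq′)) (λ eq eq′ → trans eq (sym eq′))

HasCard-ℕ-zero : {P : ℕ → Set} {k : ℕ} → P 0 → HasCard (P ∘ suc) k → HasCard P (suc k)
HasCard-ℕ-zero {P} P0 card = HasCard-resp-⇔ split
  (HasCard-⊎ (λ { _ refl (_ , () , _) })
    (HasCard-singleton 0 refl (λ _ eq → eq))
    (HasCard-image suc suc-injective card))
  where
  split : ∀ x → (x ≡ 0 ⊎ ∃[ a ] x ≡ suc a × P (suc a)) ⇔ P x
  split zero    = mk⇔ (λ _ → P0) (λ _ → inj₁ refl)
  split (suc x) = mk⇔ (λ { (inj₂ (_ , refl , p)) → p }) (λ p → inj₂ (x , refl , p))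

HasCard-Vec-Bool : ∀ {n j k} {P : Vec Bool (suc n) → Set} →
                   HasCard (λ w → P (false ∷ w)) j → HasCard (λ w → P (true ∷ w)) k →
                   HasCard P (j + k)
HasCard-Vec-Bool {n} {P = P} card₀ card₁ = HasCard-resp-⇔ split
  (HasCard-⊎ (λ { _ (_ , refl , _) (_ , () , _) })
    (HasCard-image (false ∷_) Vec.∷-injectiveʳ card₀)
    (HasCard-image (true ∷_) Vec.∷-injectiveʳ card₁))
  where
  split : ∀ w → ((∃[ v ] w ≡ false ∷ v × P (false ∷ v)) ⊎
                 (∃[ v ] w ≡ true ∷ v × P (true ∷ v))) ⇔ P w
  split (false ∷ v) = mk⇔ (λ { (inj₁ (_ , refl , p)) → p }) (λ p → inj₁ (v , refl , p))
  split (true  ∷ v) = mk⇔ (λ { (inj₂ (_ , refl , p)) → p }) (λ p → inj₂ (v , refl , p))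

-- Row lengths of staircase diagrams

Antitone : (ℕ → ℕ) → Set
Antitone h = ∀ a → h (suc a) ≤ h a

-- The number of nonempty rows plus the length of the longest row is at most n + 1, unless h = 0.
Fits : ℕ → (ℕ → ℕ) → Set
Fits n h = ∀ a → 0 < h a → a + h 0 ≤ n

antitone-≤ : ∀ {h} → Antitone h → ∀ {a b} → a ≤ b → h b ≤ h a
antitone-≤ {h} anti a≤b = go (≤⇒≤′ a≤b)
  where
  go : ∀ {a b} → a ≤′ b → h b ≤ h a
  go ≤′-refl       = ≤-refl
  go (≤′-step a≤b) = ≤-trans (anti _) (go a≤b)

Fits-antimono : ∀ {n f g} → (∀ a → f a ≤ g a) → Fits n g → Fits n f
Fits-antimono f≤g fits a 0<fa =
  ≤-trans (+-monoʳ-≤ a (f≤g 0)) (fits a (<-≤-trans 0<fa (f≤g a)))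

Fits-<ˡ : ∀ {n h} → Antitone h → Fits n h → ∀ {a} → 0 < h a → a < n
Fits-<ˡ {n} {h} anti fits {a} 0<ha = begin-strict
  a        <⟨ m<m+n a (<-≤-trans 0<ha (antitone-≤ anti z≤n)) ⟩
  a + h 0  ≤⟨ fits a 0<ha ⟩
  n        ∎
  where open ≤-Reasoning

Fits-≤ʳ : ∀ {n h} → Antitone h → Fits n h → ∀ a → h a ≤ n
Fits-≤ʳ {n} {h} anti fits a with 0 <? h 0
... | yes 0<h0 = ≤-trans (antitone-≤ anti z≤n) (fits 0 0<h0)
... | no  h0≯0 = ≤-trans (antitone-≤ anti z≤n) (≤-trans (≮⇒≥ h0≯0) z≤n)

-- Words as boundary paths

falses : ∀ {n} → Vec Bool n → ℕ
falses []          = 0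
falses (false ∷ w) = suc (falses w)
falses (true  ∷ w) = falses w

trues : ∀ {n} → Vec Bool n → ℕ
trues []          = 0
trues (false ∷ w) = trues w
trues (true  ∷ w) = suc (trues w)

trues+falses : ∀ {n} (w : Vec Bool n) → trues w + falses w ≡ n
trues+falses []          = refl
trues+falses (false ∷ w) = trans (+-suc (trues w) (falses w)) (cong suc (trues+falses w))
trues+falses (true  ∷ w) = cong suc (trues+falses w)

-- A word is the boundary path of a diagram, read from the end of the top row down to the
-- bottom left corner: true is a step down, false a step to the left.  A last step to the
-- left is implicit, so that every step down ends a nonempty row.
rowLen : ∀ {n} → Vec Bool n → ℕ → ℕ
rowLen []          _       = 0
rowLen (false ∷ w) a       = rowLen w a
rowLen (true  ∷ w) zero    = suc (falses w)
rowLen (true  ∷ w) (suc a) = rowLen w a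

rowLen≤1+falses : ∀ {n} (w : Vec Bool n) a → rowLen w a ≤ suc (falses w)
rowLen≤1+falses []          a       = z≤n
rowLen≤1+falses (false ∷ w) a       = m≤n⇒m≤1+n (rowLen≤1+falses w a)
rowLen≤1+falses (true  ∷ w) zero    = ≤-refl
rowLen≤1+falses (true  ∷ w) (suc a) = rowLen≤1+falses w a

rowLen-antitone : ∀ {n} (w : Vec Bool n) → Antitone (rowLen w)
rowLen-antitone []          a       = z≤n
rowLen-antitone (false ∷ w) a       = rowLen-antitone w a
rowLen-antitone (true  ∷ w) zero    = rowLen≤1+falses w 0
rowLen-antitone (true  ∷ w) (suc a) = rowLen-antitone w a

0<rowLen⇔<trues : ∀ {n} (w : Vec Bool n) a → 0 < rowLen w a ⇔ a < trues w
0<rowLen⇔<trues []          a       = mk⇔ (λ ()) (λ ())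
0<rowLen⇔<trues (false ∷ w) a       = 0<rowLen⇔<trues w a
0<rowLen⇔<trues (true  ∷ w) zero    = mk⇔ (λ _ → z<s) (λ _ → z<s)
0<rowLen⇔<trues (true  ∷ w) (suc a) =
  mk⇔ (s<s ∘ to (0<rowLen⇔<trues w a)) (from (0<rowLen⇔<trues w a) ∘ s<s⁻¹)

-- A nonempty row has index below `trues w`, the top row has length at most `suc (falses w)`, and
-- the two letter counts add up to `n`.
rowLen-fits : ∀ {n} (w : Vec Bool n) → Fits n (rowLen w)
rowLen-fits {n} w a 0<r = begin
  a + rowLen w 0        ≤⟨ +-monoʳ-≤ a (rowLen≤1+falses w 0) ⟩
  a + suc (falses w)    ≡⟨ +-suc a (falses w) ⟩
  suc a + falses w      ≤⟨ +-monoˡ-≤ (falses w) (to (0<rowLen⇔<trues w a) 0<r) ⟩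
  trues w + falses w    ≡⟨ trues+falses w ⟩
  n                     ∎
  where open ≤-Reasoning

-- true ∷ v attains the bound of Fits, false ∷ w does not.
rowLen-true≢false : ∀ {n} (v w : Vec Bool n) →
                    ¬ (∀ a → rowLen (true ∷ v) a ≡ rowLen (false ∷ w) a)
rowLen-true≢false {n} v w eq = 1+n≰n (begin
  suc n                        ≡⟨ cong suc (trues+falses v) ⟨
  suc (trues v + falses v)     ≡⟨ +-suc (trues v) (falses v) ⟨
  trues v + suc (falses v)     ≡⟨ cong (λ m → trues v + m) (eq 0) ⟩
  trues v + rowLen w 0         ≤⟨ rowLen-fits w (trues v)
                                    (subst (0 <_) (eq (trues v))
                                      (from (0<rowLen⇔<trues (true ∷ v) (trues v)) ≤-refl)) ⟩
  n                            ∎)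
  where open ≤-Reasoning

rowLen-injective : ∀ {n} (v w : Vec Bool n) → (∀ a → rowLen v a ≡ rowLen w a) → v ≡ w
rowLen-injective []          []          eq = refl
rowLen-injective (false ∷ v) (false ∷ w) eq = cong (false ∷_) (rowLen-injective v w eq)
rowLen-injective (true  ∷ v) (true  ∷ w) eq = cong (true ∷_) (rowLen-injective v w (eq ∘ suc))
rowLen-injective (true  ∷ v) (false ∷ w) eq = contradiction eq (rowLen-true≢false v w)
rowLen-injective (false ∷ v) (true  ∷ w) eq = contradiction (sym ∘ eq) (rowLen-true≢false w v)

≡-from-< : ∀ {m n} → (∀ a → a < m → a < n) → (∀ a → a < n → a < m) → m ≡ n
≡-from-< {m} {n} f g =
  ≤-antisym (≮⇒≥ (λ n<m → <-irrefl refl (f n n<m))) (≮⇒≥ (λ m<n → <-irrefl refl (g m m<n)))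

-- Induction on the length of the word. If the bound is not attained, the same diagram fits a
-- shorter word and the first letter is `false`; if it is attained, the first letter is `true` and
-- the top row is cut off.
rowLen-surjective : ∀ n h → Antitone h → Fits n h → ∃[ w ] (∀ a → rowLen {n} w a ≡ h a)
rowLen-surjective zero    h anti fits = [] , λ a → sym (n≤0⇒n≡0 (Fits-≤ʳ anti fits a))
-- Row `suc n ∸ h 0` is nonempty exactly when the bound is attained. The subtraction is exact, since
-- `h 0 ≤ suc n`.
rowLen-surjective (suc n) h anti fits with 0 <? h (suc n ∸ h 0)
... | no  h≯0 = let w , w≗h = rowLen-surjective n h anti fits′ in false ∷ w , w≗h
  where
  fits′ : Fits n h
  fits′ a 0<ha = s≤s⁻¹ (begin-strict
    a + h 0              <⟨ +-monoˡ-< (h 0) (≰⇒> λ d≤a →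
                              h≯0 (<-≤-trans 0<ha (antitone-≤ anti d≤a))) ⟩
    suc n ∸ h 0 + h 0    ≡⟨ m∸n+n≡m (Fits-≤ʳ anti fits 0) ⟩
    suc n                ∎)
    where open ≤-Reasoning
... | yes 0<hd = true ∷ w , λ { zero → sym h0≡ ; (suc a) → w≗h a }
  where
  d = suc n ∸ h 0
  d+h0≡ : d + h 0 ≡ suc n
  d+h0≡ = m∸n+n≡m (Fits-≤ʳ anti fits 0)
  tail = rowLen-surjective n (h ∘ suc) (anti ∘ suc)
    λ a 0<ha → ≤-trans (+-monoʳ-≤ a (anti 0)) (s≤s⁻¹ (fits (suc a) 0<ha))
  w   = proj₁ tail
  w≗h = proj₂ tail
  -- The last nonempty row of `h` is row `d`: `fits` excludes later ones, and row `d` itself is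
  -- nonempty. So the rows below the top one number `d`, which leaves `suc (falses w)` for the top
  -- row.
  trues≡ : trues w ≡ d
  trues≡ = ≡-from-<
    (λ a a<trues → +-cancelʳ-≤ (h 0) (suc a) d (≤-trans
      (fits (suc a) (subst (0 <_) (w≗h a) (from (0<rowLen⇔<trues w a) a<trues)))
      (≤-reflexive (sym d+h0≡))))
    (λ a a<d → to (0<rowLen⇔<trues w a)
      (subst (0 <_) (sym (w≗h a)) (<-≤-trans 0<hd (antitone-≤ anti a<d))))
  h0≡ : h 0 ≡ suc (falses w)
  h0≡ = +-cancelˡ-≡ d _ _ (begin
    d + h 0                     ≡⟨ d+h0≡ ⟩
    suc n                       ≡⟨ cong suc (trues+falses w) ⟨
    suc (trues w + falses w)    ≡⟨ +-suc (trues w) (falses w) ⟨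
    trues w + suc (falses w)    ≡⟨ cong (_+ suc (falses w)) trues≡ ⟩
    d + suc (falses w)          ∎)
    where open ≡-Reasoning

-- Adding and removing a box

update : (ℕ → ℕ) → ℕ → ℕ → ℕ → ℕ
update f a x b with b ≟ a
... | yes _ = x
... | no  _ = f b

update-≡ : ∀ f a x → update f a x a ≡ x
update-≡ f a x with a ≟ a
... | yes _   = refl
... | no  a≢a = contradiction refl a≢a

update-≢ : ∀ f a x {b} → b ≢ a → update f a x b ≡ f b
update-≢ f a x {b} b≢a with b ≟ a
... | yes b≡a = contradiction b≡a b≢a
... | no  _   = refl

-- Only the comparisons with the two neighbouring rows change. The one above is guarded by
-- `a ≡ suc b`, hence vacuous for the top row.
update-antitone : ∀ {f} a {x} → Antitone f → (∀ b → a ≡ suc b → x ≤ f b) → f (suc a) ≤ x →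
                  Antitone (update f a x)
update-antitone a anti x≤ ≤x b with suc b ≟ a | b ≟ a
... | yes 1+b≡a | yes b≡a  = contradiction (trans 1+b≡a (sym b≡a)) 1+n≢n
... | yes 1+b≡a | no _     = x≤ b (sym 1+b≡a)
... | no _      | yes refl = ≤x
... | no _      | no _     = anti b

-- Row lengths are used because the move has two forms on words: in a nonempty row it turns adjacent
-- letters `false`, `true` into `true`, `false`, whereas a new row drops the first letter `false`
-- and appends `true`.
record AddBox {n} (a : ℕ) (v w : Vec Bool n) : Set where
  constructor mkAddBox
  field
    at        : rowLen w a ≡ suc (rowLen v a)
    elsewhere : ∀ b → b ≢ a → rowLen w b ≡ rowLen v b

open AddBox public

AddBox-≤ : ∀ {n a} {v w : Vec Bool n} → AddBox a v w → ∀ b → rowLen v b ≤ rowLen w b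
AddBox-≤ {a = a} box b with b ≟ a
... | yes refl = ≤-trans (n≤1+n _) (≤-reflexive (sym (at box)))
... | no  b≢a  = ≤-reflexive (sym (elsewhere box b b≢a))

AddBox-injectiveʳ : ∀ {n a a′} {v w : Vec Bool n} → AddBox a v w → AddBox a′ v w → a ≡ a′
AddBox-injectiveʳ {a = a} {a′} box box′ with a ≟ a′
... | yes a≡a′ = a≡a′
... | no  a≢a′ = contradiction (trans (sym (at box)) (elsewhere box′ a a≢a′)) 1+n≢n

AddBox-functionalʳ : ∀ {n a} {v w w′ : Vec Bool n} → AddBox a v w → AddBox a v w′ → w ≡ w′
AddBox-functionalʳ {a = a} {v} {w} {w′} box box′ = rowLen-injective w w′ go
  where
  go : ∀ b → rowLen w b ≡ rowLen w′ b
  go b with b ≟ a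
  ... | yes refl = trans (at box) (sym (at box′))
  ... | no  b≢a  = trans (elsewhere box b b≢a) (sym (elsewhere box′ b b≢a))

AddBox-functionalˡ : ∀ {n a} {v v′ w : Vec Bool n} → AddBox a v w → AddBox a v′ w → v ≡ v′
AddBox-functionalˡ {a = a} {v} {v′} {w} box box′ = rowLen-injective v v′ go
  where
  go : ∀ b → rowLen v b ≡ rowLen v′ b
  go b with b ≟ a
  ... | yes refl = suc-injective (trans (sym (at box)) (at box′))
  ... | no  b≢a  = trans (sym (elsewhere box b b≢a)) (elsewhere box′ b b≢a)

addBox : ∀ {n} a (v : Vec Bool n) → Antitone (update (rowLen v) a (suc (rowLen v a))) →
         Fits n (update (rowLen v) a (suc (rowLen v a))) → ∃[ w ] AddBox a v w
addBox {n} a v anti fits =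
  let w , w≗ = rowLen-surjective n _ anti fits in
  w , mkAddBox (trans (w≗ a) (update-≡ _ a _)) (λ b b≢a → trans (w≗ b) (update-≢ _ a _ b≢a))

-- The last box of such a row is a corner of the diagram.
Descent : ∀ {n} → Vec Bool n → ℕ → Set
Descent w a = rowLen w (suc a) < rowLen w a

AddBox⇒Descent : ∀ {n a} {v w : Vec Bool n} → AddBox a v w → Descent w a
AddBox⇒Descent {a = a} {v} {w} box = begin-strict
  rowLen w (suc a)    ≡⟨ elsewhere box (suc a) 1+n≢n ⟩
  rowLen v (suc a)    ≤⟨ rowLen-antitone v a ⟩
  rowLen v a          <⟨ n<1+n _ ⟩
  suc (rowLen v a)    ≡⟨ at box ⟨
  rowLen w a          ∎
  where open ≤-Reasoning

AddBox-suc⇒Descent : ∀ {n a} {v w : Vec Bool n} → AddBox (suc a) v w → Descent v a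
AddBox-suc⇒Descent {a = a} {v} {w} box = begin-strict
  rowLen v (suc a)    <⟨ n<1+n _ ⟩
  suc (rowLen v (suc a)) ≡⟨ at box ⟨
  rowLen w (suc a)    ≤⟨ rowLen-antitone w a ⟩
  rowLen w a          ≡⟨ elsewhere box a (1+n≢n ∘ sym) ⟩
  rowLen v a          ∎
  where open ≤-Reasoning

-- `Fits` passes to smaller diagrams, so only monotonicity can prevent the removal of a box.
removable⇔Descent : ∀ {n} (w : Vec Bool n) a → (∃[ v ] AddBox a v w) ⇔ Descent w a
removable⇔Descent {n} w a = mk⇔ (AddBox⇒Descent ∘ proj₂) remove
  where
  remove : Descent w a → ∃[ v ] AddBox a v w
  remove descent with rowLen w a in eq
  ... | suc r =
    let v , v≗ = rowLen-surjective n (update (rowLen w) a r)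
          (update-antitone a (rowLen-antitone w)
            (λ { b refl → ≤-trans (n≤1+n r) (≤-trans (≤-reflexive (sym eq)) (rowLen-antitone w b)) })
            (s≤s⁻¹ descent))
          (Fits-antimono below (rowLen-fits w))
    in v , mkAddBox (trans eq (cong suc (sym (trans (v≗ a) (update-≡ _ a r)))))
                    (λ b b≢a → sym (trans (v≗ b) (update-≢ _ a r b≢a)))
    where
    below : ∀ b → update (rowLen w) a r b ≤ rowLen w b
    below b with b ≟ a
    ... | yes refl = ≤-trans (n≤1+n r) (≤-reflexive (sym eq))
    ... | no  _    = ≤-refl

-- The top row keeps its length, so `Fits` needs checking only at row `suc a`, which may have been
-- empty before.
addBox-suc : ∀ {n} (v : Vec Bool n) a → Descent v a → suc a + rowLen v 0 ≤ n →
             ∃[ w ] AddBox (suc a) v w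
addBox-suc {n} v a descent bound = addBox (suc a) v
  (update-antitone (suc a) (rowLen-antitone v) (λ { b refl → descent })
    (m≤n⇒m≤1+n (rowLen-antitone v (suc a))))
  fits
  where
  fits : Fits n (update (rowLen v) (suc a) (suc (rowLen v (suc a))))
  fits b 0<r with b ≟ suc a
  ... | yes refl = bound
  ... | no  _    = rowLen-fits v b 0<r

-- The diagram already satisfies the bound for `n`, and the spare unit in `suc n` admits even a new
-- row.
addable-false : ∀ {n} (w : Vec Bool n) a →
                Descent w a ⇔ (∃[ v ] AddBox (suc a) (false ∷ w) v)
addable-false w a = mk⇔
  (λ descent → addBox-suc (false ∷ w) a descent (s≤s (rowLen-fits w a (≤-<-trans z≤n descent))))
  (AddBox-suc⇒Descent ∘ proj₂)

addable-false-0 : ∀ {n} (w : Vec Bool n) → ∃[ v ] AddBox 0 (false ∷ w) v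
addable-false-0 {n} w = addBox 0 (false ∷ w)
  (update-antitone 0 (rowLen-antitone w) (λ _ ()) (m≤n⇒m≤1+n (rowLen-antitone w 0)))
  fits
  where
  fits : Fits (suc n) (update (rowLen w) 0 (suc (rowLen w 0)))
  fits zero    _   = s≤s (Fits-≤ʳ (rowLen-antitone w) (rowLen-fits w) 0)
  fits (suc a) 0<r = subst (_≤ suc n) (sym (+-suc (suc a) (rowLen w 0)))
    (s≤s (rowLen-fits w (suc a) 0<r))

-- The bound is attained: row `trues w` is nonempty, and a longer top row would exceed the bound
-- there.
¬addable-true-0 : ∀ {n} (w : Vec Bool n) → ¬ (∃[ v ] AddBox 0 (true ∷ w) v)
¬addable-true-0 {n} w (v , box) = 1+n≰n (begin
  suc (suc n)                         ≡⟨ cong (suc ∘ suc) (trues+falses w) ⟨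
  suc (suc (trues w + falses w))      ≡⟨ cong suc (+-suc (trues w) (falses w)) ⟨
  suc (trues w + suc (falses w))      ≡⟨ +-suc (trues w) (suc (falses w)) ⟨
  trues w + suc (suc (falses w))      ≡⟨ cong (λ m → trues w + m) (at box) ⟨
  trues w + rowLen v 0                ≤⟨ rowLen-fits v (trues w) (<-≤-trans
                                           (from (0<rowLen⇔<trues (true ∷ w) (trues w)) ≤-refl)
                                           (AddBox-≤ box (trues w))) ⟩
  suc n                               ∎)
  where open ≤-Reasoning

-- Row `trues w` is the last nonempty one. A box below it would start a new row, which the attained
-- bound forbids; every other place below a corner lies in a row already counted.
addable-true : ∀ {n} (w : Vec Bool n) a →
               (Descent (true ∷ w) a × a ≢ trues w) ⇔ (∃[ v ] AddBox (suc a) (true ∷ w) v)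
addable-true {n} w a = mk⇔ add (λ (v , box) → AddBox-suc⇒Descent box , a≢ v box)
  where
  open ≤-Reasoning
  add : Descent (true ∷ w) a × a ≢ trues w → ∃[ v ] AddBox (suc a) (true ∷ w) v
  add (descent , a≢) = addBox-suc (true ∷ w) a descent (begin
    suc a + suc (falses w)      ≤⟨ +-monoˡ-≤ (suc (falses w)) (≤∧≢⇒< (s≤s⁻¹
                                     (to (0<rowLen⇔<trues (true ∷ w) a) (≤-<-trans z≤n descent))) a≢) ⟩
    trues w + suc (falses w)    ≡⟨ +-suc (trues w) (falses w) ⟩
    suc (trues w + falses w)    ≡⟨ cong suc (trues+falses w) ⟩
    suc n                       ∎)
  a≢ : ∀ v → AddBox (suc a) (true ∷ w) v → a ≢ trues w
  a≢ v box refl = 1+n≰n (begin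
    suc (suc n)                         ≡⟨ cong (suc ∘ suc) (trues+falses w) ⟨
    suc (suc (trues w + falses w))      ≡⟨ cong suc (+-suc (trues w) (falses w)) ⟨
    suc (trues w) + suc (falses w)      ≡⟨ cong (λ m → suc (trues w) + m) (elsewhere box 0 λ ()) ⟨
    suc (trues w) + rowLen v 0          ≤⟨ rowLen-fits v (suc (trues w))
                                             (subst (0 <_) (sym (at box)) z<s) ⟩
    suc n                               ∎)

-- Counting descents

-- The number of maximal blocks of `true`: each block is followed by a step to the left, the
-- implicit one for a block at the end, and so ends in a corner.
κ : ∀ {n} → Vec Bool n → ℕ
κ []                 = 0
κ (false ∷ w)        = κ w
κ (true ∷ [])        = 1
κ (true ∷ true ∷ w)  = κ (true ∷ w)
κ (true ∷ false ∷ w) = suc (κ w)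

κ-true : ∀ {n} (w : Vec Bool n) → ∃[ k ] κ (true ∷ w) ≡ suc k
κ-true []          = 0 , refl
κ-true (false ∷ w) = κ w , refl
κ-true (true  ∷ w) = κ-true w

HasCard-Descent : ∀ {n} (w : Vec Bool n) → HasCard (Descent w) (κ w)
HasCard-Descent []                 = HasCard-∅ λ _ ()
HasCard-Descent (false ∷ w)        = HasCard-Descent w
HasCard-Descent (true ∷ [])        = HasCard-ℕ-zero z<s (HasCard-∅ λ _ ())
HasCard-Descent (true ∷ true ∷ w)  = HasCard-ℕ-suc (<-irrefl refl) (HasCard-Descent (true ∷ w))
HasCard-Descent (true ∷ false ∷ w) =
  HasCard-ℕ-zero (s≤s (rowLen≤1+falses w 0)) (HasCard-Descent w)

ι : ∀ {n} → Vec Bool n → ℕ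
ι []          = 0
ι (false ∷ w) = suc (κ w)
ι (true  ∷ w) = pred (κ (true ∷ w))

HasCard-addable : ∀ {n} (w : Vec Bool (suc n)) → HasCard (λ a → ∃[ v ] AddBox a w v) (ι w)
HasCard-addable (false ∷ w) = HasCard-ℕ-zero (addable-false-0 w)
  (HasCard-resp-⇔ (addable-false w) (HasCard-Descent w))
HasCard-addable (true ∷ w) = HasCard-ℕ-suc (¬addable-true-0 w)
  (HasCard-resp-⇔ (addable-true w) (HasCard-remove (trues w) last-descent
    -- `κ (true ∷ w)` is positive, hence the successor of its predecessor, as `HasCard-remove`
    -- requires.
    (subst (HasCard _) (trans κ≡ (cong suc (cong pred (sym κ≡)))) (HasCard-Descent (true ∷ w)))))
  where
  κ≡ = proj₂ (κ-true w)
  last-descent : Descent (true ∷ w) (trues w)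
  last-descent = ≤-<-trans
    (≮⇒≥ λ 0<r → <-irrefl refl (to (0<rowLen⇔<trues w (trues w)) 0<r))
    (from (0<rowLen⇔<trues (true ∷ w) (trues w)) ≤-refl)

-- Turns are counted at the `suc n` gaps of the framed path. It ends with a left step, so the number
-- of turns is even if it starts with a left step and odd if it starts with a step down. Splitting
-- by the next letter gives Pascal's rule.
HasCard-κ      : ∀ n k → HasCard {Vec Bool n} (λ w → κ w ≡ k) (suc n C (2 * k))
HasCard-κ-true : ∀ n k → HasCard {Vec Bool n} (λ w → κ (true ∷ w) ≡ suc k) (suc n C suc (2 * k))

HasCard-κ zero    zero    = HasCard-singleton [] refl λ { [] _ → refl }
HasCard-κ zero    (suc k) =
  subst (HasCard _) (sym (k>n⇒nCk≡0 (*-monoʳ-≤ 2 (s≤s (z≤n {k}))))) (HasCard-∅ λ { [] () })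
HasCard-κ (suc n) zero    = HasCard-Vec-Bool (HasCard-κ n 0)
  (HasCard-∅ λ w κ≡0 → 1+n≢0 (trans (sym (proj₂ (κ-true w))) κ≡0))
HasCard-κ (suc n) (suc k) = subst (HasCard _)
  (trans (+-comm (suc n C (2 * suc k)) _) pascal)
  (HasCard-Vec-Bool (HasCard-κ n (suc k)) (HasCard-κ-true n k))
  where
  pascal : suc n C suc (2 * k) + suc n C (2 * suc k) ≡ suc (suc n) C (2 * suc k)
  pascal = subst (λ j → suc n C suc (2 * k) + suc n C j ≡ suc (suc n) C j)
    (sym (*-suc 2 k)) (nCk+nC[k+1]≡[n+1]C[k+1] (suc n) (suc (2 * k)))

HasCard-κ-true zero    zero    = HasCard-singleton [] refl λ { [] _ → refl }
HasCard-κ-true zero    (suc k) =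
  subst (HasCard _) (sym (k>n⇒nCk≡0 (s≤s (z<s {k + 1 * suc k})))) (HasCard-∅ λ { [] () })
HasCard-κ-true (suc n) k       = subst (HasCard _)
  (nCk+nC[k+1]≡[n+1]C[k+1] (suc n) (2 * k))
  (HasCard-Vec-Bool
    (HasCard-resp-⇔ (λ _ → mk⇔ (cong suc) suc-injective) (HasCard-κ n k))
    (HasCard-κ-true n k))

-- The two binomials come from the two values of the first letter: after `false` a word with `k`
-- upper covers has one corner fewer, after `true` one corner more.
HasCard-ι : ∀ n k → HasCard {Vec Bool (suc n)} (λ w → ι w ≡ k) (lRHS (suc n) k)
HasCard-ι n k = subst (HasCard _) (+-comm (binom2km2 (suc n) k) _)
  (HasCard-Vec-Bool (false-part k) (HasCard-resp-⇔ true-part (HasCard-κ-true n k)))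
  where
  false-part : ∀ k → HasCard {Vec Bool n} (λ w → suc (κ w) ≡ k) (binom2km2 (suc n) k)
  false-part zero    = HasCard-∅ λ _ ()
  false-part (suc k) = HasCard-resp-⇔ (λ _ → mk⇔ (cong suc) suc-injective) (HasCard-κ n k)
  true-part : ∀ (w : Vec Bool n) → κ (true ∷ w) ≡ suc k ⇔ pred (κ (true ∷ w)) ≡ k
  true-part w = mk⇔ (cong pred)
    (λ eq → trans (proj₂ (κ-true w)) (cong suc (trans (cong pred (sym (proj₂ (κ-true w)))) eq)))

-- Roots

private
  -- `ε i k` is this function applied to `does (i Fin.≟ k)`, so an identity of roots at one
  -- coordinate becomes a finite check on Booleans.
  ⟦_⟧ : Bool → ℤ
  ⟦ b ⟧ = if b then + 1 else + 0

  does-true : ∀ {P : Set} (P? : Dec P) → does P? ≡ true → P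
  does-true (yes p) _ = p

  ε-refl : ∀ {n} (i : Fin (suc n)) → ε i i ≡ + 1
  ε-refl i = cong ⟦_⟧ (dec-true (i Fin.≟ i) refl)

  ε-≢ : ∀ {n} {i k : Fin (suc n)} → i ≢ k → ε i k ≡ + 0
  ε-≢ {i = i} {k} i≢k = cong ⟦_⟧ (dec-false (i Fin.≟ k) i≢k)

  +1-split : ∀ x y z w → + 1 ≡ (⟦ x ⟧ ℤ.- ⟦ y ⟧) ℤ.+ (⟦ z ⟧ ℤ.- ⟦ w ⟧) →
             x ≡ true ⊎ z ≡ true
  +1-split true  _     _     _     _ = inj₁ refl
  +1-split false _     true  _     _ = inj₂ refl
  +1-split false false false false ()
  +1-split false false false true  ()
  +1-split false true  false false ()
  +1-split false true  false true  ()

  -1-split : ∀ x y z w → ℤ.- (+ 1) ≡ (⟦ x ⟧ ℤ.- ⟦ y ⟧) ℤ.+ (⟦ z ⟧ ℤ.- ⟦ w ⟧) →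
             y ≡ true ⊎ w ≡ true
  -1-split _     true  _     _     _ = inj₁ refl
  -1-split _     false _     true  _ = inj₂ refl
  -1-split false false false false ()
  -1-split false false true  false ()
  -1-split true  false false false ()
  -1-split true  false true  false ()

  +1-cancel : ∀ y w → + 0 ℤ.- ⟦ y ⟧ ≡ (+ 1 ℤ.- + 0) ℤ.+ (+ 0 ℤ.- ⟦ w ⟧) → w ≡ true
  +1-cancel _     true  _ = refl
  +1-cancel false false ()
  +1-cancel true  false ()

  -1-cancel : ∀ x z → ⟦ x ⟧ ℤ.- + 0 ≡ (+ 0 ℤ.- + 1) ℤ.+ (⟦ z ⟧ ℤ.- + 0) → z ≡ true
  -1-cancel _     true  _ = refl
  -1-cancel false false ()
  -1-cancel true  false ()

  -- The left side is at most 1, so the second summand on the right cannot contribute another 1.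
  +1-double : ∀ x y z → ⟦ x ⟧ ℤ.- ⟦ y ⟧ ≡ (+ 1 ℤ.- + 0) ℤ.+ (⟦ z ⟧ ℤ.- + 0) →
              x ≡ true × z ≡ false
  +1-double true  _     false _ = refl , refl
  +1-double true  false true  ()
  +1-double true  true  true  ()
  +1-double false false false ()
  +1-double false false true  ()
  +1-double false true  false ()
  +1-double false true  true  ()

row col : ∀ {n} → Root n → Fin (suc n)
row ((i , _) , _) = i
col ((_ , j) , _) = j

-- With the simple root written as `ε p` minus `ε q`, the coordinate +1 at `i′` must come from `i`
-- or `p`, and the coordinate -1 at `j′` from `j` or `q`.
⋖ʳ⇒≤ : ∀ {n} (μ γ : Root n) → μ ⋖ʳ γ → row γ Fin.≤ row μ × col μ Fin.≤ col γ
⋖ʳ⇒≤ ((i , j) , i<j) ((i′ , j′) , i′<j′) (a , eq) = rows , cols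
  where
  p = inject₁ a
  q = Fin.suc a
  p≤q : p Fin.≤ q
  p≤q = ≤-trans (≤-reflexive (Fin.toℕ-inject₁ a)) (n≤1+n _)
  at-i′ : i ≡ i′ ⊎ p ≡ i′
  at-i′ with e ← eq i′ rewrite ε-refl i′ | ε-≢ {i = j′} {i′} (≢-sym (Fin.<⇒≢ i′<j′))
    with +1-split (does (i Fin.≟ i′)) (does (j Fin.≟ i′)) (does (p Fin.≟ i′)) (does (q Fin.≟ i′)) e
  ... | inj₁ x = inj₁ (does-true (i Fin.≟ i′) x)
  ... | inj₂ z = inj₂ (does-true (p Fin.≟ i′) z)
  at-j′ : j ≡ j′ ⊎ q ≡ j′
  at-j′ with e ← eq j′ rewrite ε-refl j′ | ε-≢ {i = i′} {j′} (Fin.<⇒≢ i′<j′)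
    with -1-split (does (i Fin.≟ j′)) (does (j Fin.≟ j′)) (does (p Fin.≟ j′)) (does (q Fin.≟ j′)) e
  ... | inj₁ y = inj₁ (does-true (j Fin.≟ j′) y)
  ... | inj₂ w = inj₂ (does-true (q Fin.≟ j′) w)
  rows : i′ Fin.≤ i
  rows with i Fin.≟ i′ | at-i′
  ... | yes refl | _         = ≤-refl
  ... | no  i≢i′ | inj₁ i≡i′ = contradiction i≡i′ i≢i′
  -- Now `i′` is `p`, and `γ` has no +1 at `i`; the +1 of `μ` there is cancelled, which forces
  -- `q ≡ i`. The columns are treated dually.
  ... | no  i≢i′ | inj₂ refl
    with e ← eq i rewrite ε-refl i | ε-≢ {i = j} {i} (≢-sym (Fin.<⇒≢ i<j))
                        | ε-≢ {i = p} {i} (≢-sym i≢i′)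
    with does-true (q Fin.≟ i) (+1-cancel (does (j′ Fin.≟ i)) (does (q Fin.≟ i)) e)
  ... | refl = p≤q
  cols : j Fin.≤ j′
  cols with j Fin.≟ j′ | at-j′
  ... | yes refl | _         = ≤-refl
  ... | no  j≢j′ | inj₁ j≡j′ = contradiction j≡j′ j≢j′
  ... | no  j≢j′ | inj₂ refl
    with e ← eq j rewrite ε-refl j | ε-≢ {i = i} {j} (Fin.<⇒≢ i<j)
                        | ε-≢ {i = q} {j} (≢-sym j≢j′)
    with does-true (p Fin.≟ j) (-1-cancel (does (i′ Fin.≟ j)) (does (p Fin.≟ j)) e)
  ... | refl = p≤q

≼⇒≤ : ∀ {n} {μ γ : Root n} → μ ≼ γ → row γ Fin.≤ row μ × col μ Fin.≤ col γ
≼⇒≤ done = ≤-refl , ≤-refl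
≼⇒≤ {μ = μ} {γ} (_◅_ {j = ν} μ⋖ν ν≼γ) =
  let r , c   = ⋖ʳ⇒≤ μ ν μ⋖ν
      r′ , c′ = ≼⇒≤ ν≼γ
  in ≤-trans r′ r , ≤-trans c c′

-- At `i` no negative term of the sum is present, so its coordinate is at least 1. A root has no
-- coordinate 2, hence `i ≢ i′` and `p ≡ i`; by symmetry `p ≡ i′`.
sum-not-root : ∀ {n} (γ δ : Root n) → row γ Fin.< col δ → row δ Fin.< col γ →
               ¬ IsPosRoot (λ k → vec γ k ℤ.+ vec δ k)
sum-not-root ((i , j) , i<j) ((i′ , j′) , i′<j′) i<j′ i′<j (((p , q) , p<q) , eq) =
  contradiction (trans (sym p≡i) p≡i′) i≢i′
  where
  at-i : p ≡ i × does (i′ Fin.≟ i) ≡ false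
  at-i with e ← eq i rewrite ε-refl i | ε-≢ {i = j} {i} (≢-sym (Fin.<⇒≢ i<j))
                           | ε-≢ {i = j′} {i} (≢-sym (Fin.<⇒≢ i<j′))
    with +1-double (does (p Fin.≟ i)) (does (q Fin.≟ i)) (does (i′ Fin.≟ i)) e
  ... | x , z = does-true (p Fin.≟ i) x , z
  p≡i = proj₁ at-i
  i≢i′ : i ≢ i′
  i≢i′ refl = contradiction (trans (sym (dec-true (i Fin.≟ i) refl)) (proj₂ at-i)) λ ()
  p≡i′ : p ≡ i′
  p≡i′ with e ← eq i′ rewrite ε-refl i′ | ε-≢ {i = j} {i′} (≢-sym (Fin.<⇒≢ i′<j))
                            | ε-≢ {i = j′} {i′} (≢-sym (Fin.<⇒≢ i′<j′))
                            | ε-≢ {i = i} {i′} i≢i′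
    = does-true (p Fin.≟ i′) (proj₁ (+1-double (does (p Fin.≟ i′)) (does (q Fin.≟ i′)) false e))

-- The ideal of a word

-- `opposite` reverses the columns, so that the up-closed part of a row starts at 0. Outside this
-- block ideals are accessible only through `entry-ideal`.
abstract
  ideal : ∀ {n} → Vec Bool n → RSet n
  ideal w = tabulate λ i → tabulate λ j → toℕ (opposite j) <ᵇ rowLen w (toℕ i)

  entry-ideal : ∀ {n} (w : Vec Bool n) i j →
                entry (ideal w) i j ≡ true ⇔ toℕ (opposite j) < rowLen w (toℕ i)
  entry-ideal w i j = mk⇔
    (λ eq → <ᵇ⇒< _ _ (from Bool.T-≡ (trans (sym entry≡) eq)))
    (λ lt → trans entry≡ (to Bool.T-≡ (<⇒<ᵇ lt)))
    where
    entry≡ : entry (ideal w) i j ≡ (toℕ (opposite j) <ᵇ rowLen w (toℕ i))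
    entry≡ = trans
      (cong (λ v → lookup v j) (Vec.lookup∘tabulate
        (λ i → tabulate λ j → toℕ (opposite j) <ᵇ rowLen w (toℕ i)) i))
      (Vec.lookup∘tabulate (λ j → toℕ (opposite j) <ᵇ rowLen w (toℕ i)) j)

toℕ+opposite : ∀ {n} (j : Fin (suc n)) → toℕ j + toℕ (opposite j) ≡ n
toℕ+opposite j = trans (cong (λ m → toℕ j + m) (Fin.opposite-prop j)) (m+[n∸m]≡n (s≤s⁻¹ (Fin.toℕ<n j)))

opposite-cancel-≤ : ∀ {n} {i j : Fin (suc n)} → opposite j Fin.≤ opposite i → i Fin.≤ j
opposite-cancel-≤ {i = i} {j} j≤i = +-cancelʳ-≤ (toℕ (opposite j)) _ _ (begin
  toℕ i + toℕ (opposite j)    ≤⟨ +-monoʳ-≤ (toℕ i) j≤i ⟩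
  toℕ i + toℕ (opposite i)    ≡⟨ toℕ+opposite i ⟩
  _                           ≡⟨ toℕ+opposite j ⟨
  toℕ j + toℕ (opposite j)    ∎)
  where open ≤-Reasoning

opposite-mono-≤ : ∀ {n} {i j : Fin (suc n)} → i Fin.≤ j → opposite j Fin.≤ opposite i
opposite-mono-≤ {i = i} {j} i≤j = opposite-cancel-≤
  (subst₂ Fin._≤_ (sym (Fin.opposite-involutive i)) (sym (Fin.opposite-involutive j)) i≤j)

-- This is `Fits` in terms of indices. For a single root it says that the entry is a positive root;
-- for two roots it supplies the hypotheses of `sum-not-root`.
ideal-separated : ∀ {n} (w : Vec Bool n) {i j i′ j′} → entry (ideal w) i j ≡ true →
                  entry (ideal w) i′ j′ ≡ true → i Fin.< j′
ideal-separated {n} w {i} {j} {i′} {j′} ∈ij ∈i′j′ =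
  +-cancelʳ-< (toℕ (opposite j′)) _ _ (begin-strict
    toℕ i + toℕ (opposite j′)     <⟨ +-monoʳ-< (toℕ i) (to (entry-ideal w i′ j′) ∈i′j′) ⟩
    toℕ i + rowLen w (toℕ i′)     ≤⟨ +-monoʳ-≤ (toℕ i) (antitone-≤ (rowLen-antitone w) z≤n) ⟩
    toℕ i + rowLen w 0            ≤⟨ rowLen-fits w (toℕ i) (≤-<-trans z≤n
                                       (to (entry-ideal w i j) ∈ij)) ⟩
    n                             ≡⟨ toℕ+opposite j′ ⟨
    toℕ j′ + toℕ (opposite j′)    ∎)
  where open ≤-Reasoning

ideal-InAb : ∀ {n} (w : Vec Bool n) → InAb (ideal w)
ideal-InAb w = ((λ i j ∈ij → ideal-separated w ∈ij ∈ij) , up) , abelian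
  where
  up : ∀ γ δ → γ ≼ δ → γ ∈ʳ ideal w → δ ∈ʳ ideal w
  up ((i , j) , _) ((i′ , j′) , _) γ≼δ ∈γ =
    let i′≤i , j≤j′ = ≼⇒≤ γ≼δ in
    from (entry-ideal w i′ j′) (≤-<-trans (opposite-mono-≤ {i = j} j≤j′)
      (<-≤-trans (to (entry-ideal w i j) ∈γ) (antitone-≤ (rowLen-antitone w) i′≤i)))
  abelian : IsAbelian (ideal w)
  abelian γ@((i , j) , _) δ@((i′ , j′) , _) ∈γ ∈δ =
    sum-not-root γ δ (ideal-separated w ∈γ ∈δ) (ideal-separated w ∈δ ∈γ)

RSet-ext : ∀ {n} {x y : RSet n} → (∀ i j → entry x i j ≡ true ⇔ entry y i j ≡ true) → x ≡ y
RSet-ext eq = lookup-ext λ i → lookup-ext λ j → Bool.⇔→≡ (eq i j)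
  where
  lookup-ext : ∀ {A : Set} {n} {u v : Vec A n} → (∀ i → lookup u i ≡ lookup v i) → u ≡ v
  lookup-ext {u = u} {v} eq =
    trans (sym (Vec.tabulate∘lookup u)) (trans (Vec.tabulate-cong eq) (Vec.tabulate∘lookup v))

initial-segment : ∀ N {P : ℕ → Set} → Decidable P → (∀ {a b} → a ≤ b → P b → P a) →
                  (∀ b → P b → b < N) → ∃[ c ] (∀ b → P b ⇔ b < c)
initial-segment zero    P? down bound = 0 , λ b → mk⇔ (bound b) (λ ())
initial-segment (suc N) P? down bound with P? N
... | yes pN = suc N , λ b → mk⇔ (bound b) (λ b<1+N → down (s≤s⁻¹ b<1+N) pN)
... | no ¬pN = initial-segment N P? down
  λ b pb → ≤∧≢⇒< (s≤s⁻¹ (bound b pb)) λ { refl → ¬pN pb }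

-- Every abelian ideal comes from a word

module _ {n : ℕ} (x : RSet n) (x∈Ab : InAb x) where

  private
    rootSubset = proj₁ (proj₁ x∈Ab)
    upper      = proj₂ (proj₁ x∈Ab)
    abelian    = proj₂ x∈Ab

    -- Moving up one row adds the simple root of that index, so the upper ideal property applies
    -- step by step; `rootSubset` keeps each intermediate pair a root.
    entry-up-row : ∀ {i i′ j} → i′ Fin.≤ i → entry x i j ≡ true → entry x i′ j ≡ true
    entry-up-row {i} {i′} {j} i′≤i = <-weakInduction-startingFrom
      (λ i → entry x i j ≡ true → entry x i′ j ≡ true) id
      (λ a ih ∈aj → let a<j = rootSubset (Fin.suc a) j ∈aj in
        ih (upper ((Fin.suc a , j) , a<j)
          ((inject₁ a , j) , ≤-<-trans (≤-trans (≤-reflexive (Fin.toℕ-inject₁ a)) (n≤1+n _)) a<j)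
          ((a , λ k → telescope (ε (inject₁ a) k) (ε (Fin.suc a) k) (ε j k)) ◅ done)
          ∈aj)) i′≤i
      where
      telescope : ∀ p q j → p ℤ.- j ≡ (q ℤ.- j) ℤ.+ (p ℤ.- q)
      telescope = ℤ-Solver.solve-∀

    entry-up-col : ∀ {i j j′} → j Fin.≤ j′ → entry x i j ≡ true → entry x i j′ ≡ true
    entry-up-col {i} {j} {j′} j≤j′ ∈ij = <-weakInduction-startingFrom
      (λ j → entry x i j ≡ true) ∈ij
      (λ a ∈ia → let i<a = rootSubset i (inject₁ a) ∈ia in
        upper ((i , inject₁ a) , i<a)
          ((i , Fin.suc a) , <-≤-trans i<a (≤-trans (≤-reflexive (Fin.toℕ-inject₁ a)) (n≤1+n _)))
          ((a , λ k → telescope (ε i k) (ε (inject₁ a) k) (ε (Fin.suc a) k)) ◅ done)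
          ∈ia) j≤j′
      where
      telescope : ∀ i p q → i ℤ.- q ≡ (i ℤ.- p) ℤ.+ (p ℤ.- q)
      telescope = ℤ-Solver.solve-∀

    -- If `j′ ≤ i`, the second root can be raised until its column is `i`; its sum with the first
    -- root then telescopes to a root, contrary to abelianness.
    separated : ∀ {i j i′ j′} → entry x i j ≡ true → entry x i′ j′ ≡ true → i Fin.< j′
    separated {i} {j} {i′} {j′} ∈ij ∈i′j′ = ≰⇒> λ j′≤i →
      let i<j   = rootSubset i j ∈ij
          i′<i  = <-≤-trans (rootSubset i′ j′ ∈i′j′) j′≤i
      in abelian ((i′ , i) , i′<i) ((i , j) , i<j) (entry-up-col j′≤i ∈i′j′) ∈ij
           (((i′ , j) , <-trans i′<i i<j) ,
            λ k → telescope (ε i′ k) (ε i k) (ε j k))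
      where
      telescope : ∀ i′ i j → i′ ℤ.- j ≡ (i′ ℤ.- i) ℤ.+ (i ℤ.- j)
      telescope = ℤ-Solver.solve-∀

    -- Boxes get natural number coordinates, and those outside the table are simply unoccupied.
    Cell : ℕ → ℕ → Set
    Cell a b = ∃[ i ] ∃[ j ] toℕ i ≡ a × toℕ (opposite j) ≡ b × entry x i j ≡ true

    Cell? : ∀ a → Decidable (Cell a)
    Cell? a b = Fin.any? λ i → Fin.any? λ j →
      (toℕ i ≟ a) ×-dec (toℕ (opposite j) ≟ b) ×-dec (entry x i j Bool.≟ true)

    Cell-downʳ : ∀ a {b b′} → b ≤ b′ → Cell a b′ → Cell a b
    Cell-downʳ a {b} b≤b′ (i , j , refl , refl , ∈ij) =
      i , opposite k , refl , opp-k , entry-up-col (opposite-cancel-≤ {i = j} {opposite k}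
        (≤-trans (≤-reflexive opp-k) b≤b′)) ∈ij
      where
      k = fromℕ< (≤-<-trans b≤b′ (Fin.toℕ<n (opposite j)))
      opp-k : toℕ (opposite (opposite k)) ≡ b
      opp-k = trans (cong toℕ (Fin.opposite-involutive k)) (Fin.toℕ-fromℕ< _)

    Cell-downˡ : ∀ {a b} → Cell (suc a) b → Cell a b
    Cell-downˡ (Fin.suc i , j , refl , eq , ∈ij) =
      inject₁ i , j , Fin.toℕ-inject₁ i , eq ,
      entry-up-row (≤-trans (≤-reflexive (Fin.toℕ-inject₁ i)) (n≤1+n _)) ∈ij

    Cell-separated : ∀ {a b a′ b′} → Cell a b → Cell a′ b′ → a + b′ < n
    Cell-separated (i , j , refl , refl , ∈ij) (i′ , j′ , refl , refl , ∈i′j′) =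
      <-≤-trans (+-monoˡ-< (toℕ (opposite j′)) (separated ∈ij ∈i′j′))
                (≤-reflexive (toℕ+opposite j′))

    segment : ∀ a → ∃[ c ] (∀ b → Cell a b ⇔ b < c)
    segment a = initial-segment n (Cell? a) (Cell-downʳ a)
      (λ b cell → ≤-<-trans (m≤n+m b a) (Cell-separated cell cell))

    width : ℕ → ℕ
    width = proj₁ ∘ segment

    Cell⇔< : ∀ a b → Cell a b ⇔ b < width a
    Cell⇔< = proj₂ ∘ segment

    width-antitone : Antitone width
    width-antitone a = ≮⇒≥ λ lt → <-irrefl refl
      (to (Cell⇔< a (width a)) (Cell-downˡ (from (Cell⇔< (suc a) (width a)) lt)))

    -- The first box of row `a` and the last box of the top row are separated, which is exactly the
    -- bound.
    width-fits : Fits n width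
    width-fits a 0<wa with width 0 in eq
    ... | zero  = <⇒≤ (Cell-separated cell cell)
      where cell = from (Cell⇔< a 0) 0<wa
    ... | suc c = subst (_≤ n) (sym (+-suc a c)) (Cell-separated (from (Cell⇔< a 0) 0<wa)
                    (from (Cell⇔< 0 c) (subst (c <_) (sym eq) ≤-refl)))

  ideal-surjective : ∃[ w ] x ≡ ideal w
  ideal-surjective = w , RSet-ext λ i j → ⇔-trans (entry⇔Cell i j) (⇔-trans (Cell⇔< _ _)
    (subst (λ r → toℕ (opposite j) < r ⇔ entry (ideal w) i j ≡ true) (w≗ (toℕ i))
      (⇔-sym (entry-ideal w i j))))
    where
    realised = rowLen-surjective n width width-antitone width-fits
    w   = proj₁ realised
    w≗  = proj₂ realised
    entry⇔Cell : ∀ i j → entry x i j ≡ true ⇔ Cell (toℕ i) (toℕ (opposite j))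
    entry⇔Cell i j = mk⇔ (λ ∈ij → i , j , refl , refl , ∈ij) back
      where
      back : Cell (toℕ i) (toℕ (opposite j)) → entry x i j ≡ true
      back (i′ , j′ , i≡ , j≡ , ∈i′j′) = subst₂ (λ i j → entry x i j ≡ true)
        (Fin.toℕ-injective i≡)
        (trans (sym (Fin.opposite-involutive j′))
          (trans (cong opposite (Fin.toℕ-injective j≡)) (Fin.opposite-involutive j)))
        ∈i′j′

-- If row `a` is longer for `v`, its box at position `rowLen w a` belongs to `ideal v` only. `Fits`
-- guarantees that this box lies inside the table.
ideal-⊆⇔ : ∀ {n} (v w : Vec Bool n) → ideal v ⊆ʳ ideal w ⇔ (∀ a → rowLen v a ≤ rowLen w a)
ideal-⊆⇔ {n} v w = mk⇔ (λ v⊆w a → ≮⇒≥ (⊈ v⊆w a))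
  (λ v≤w i j ∈v → from (entry-ideal w i j) (<-≤-trans (to (entry-ideal v i j) ∈v) (v≤w (toℕ i))))
  where
  ⊈ : ideal v ⊆ʳ ideal w → ∀ a → ¬ (rowLen w a < rowLen v a)
  ⊈ v⊆w a lt = <-irrefl refl (subst₂ (λ b a → b < rowLen w a) opp-j toℕ-i
    (to (entry-ideal w i j) (v⊆w i j (from (entry-ideal v i j)
      (subst₂ (λ b a → b < rowLen v a) (sym opp-j) (sym toℕ-i) lt)))))
    where
    a<1+n : a < suc n
    a<1+n = m<n⇒m<1+n (Fits-<ˡ (rowLen-antitone v) (rowLen-fits v) (≤-<-trans z≤n lt))
    b<1+n : rowLen w a < suc n
    b<1+n = s≤s (Fits-≤ʳ (rowLen-antitone w) (rowLen-fits w) a)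
    i = fromℕ< a<1+n
    j = opposite (fromℕ< b<1+n)
    toℕ-i : toℕ i ≡ a
    toℕ-i = Fin.toℕ-fromℕ< a<1+n
    opp-j : toℕ (opposite j) ≡ rowLen w a
    opp-j = trans (cong toℕ (Fin.opposite-involutive _)) (Fin.toℕ-fromℕ< b<1+n)

ideal-injective : ∀ {n} {v w : Vec Bool n} → ideal v ≡ ideal w → v ≡ w
ideal-injective {v = v} {w} eq = rowLen-injective v w λ a → ≤-antisym
  (to (ideal-⊆⇔ v w) (λ i j → subst (λ x → entry x i j ≡ true) eq) a)
  (to (ideal-⊆⇔ w v) (λ i j → subst (λ x → entry x i j ≡ true) (sym eq)) a)

-- Covering relations

-- Agreement in the row above is what will let row `a` of the smaller diagram grow.
first-difference : ∀ n {f g : ℕ → ℕ} → (∀ a → f a ≤ g a) →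
  (∀ a → a < n → f a ≡ g a) ⊎ (∃[ a ] f a < g a × (∀ b → a ≡ suc b → f b ≡ g b))
first-difference zero    f≤g = inj₁ λ _ ()
first-difference (suc n) {f} {g} f≤g with first-difference n f≤g
... | inj₂ diff = inj₂ diff
... | inj₁ same with f n <? g n
...   | yes fn<gn = inj₂ (n , fn<gn , λ { b refl → same b ≤-refl })
...   | no  fn≮gn = inj₁ same′
  where
  same′ : ∀ a → a < suc n → f a ≡ g a
  same′ a a<1+n with m≤n⇒m<n∨m≡n (s≤s⁻¹ a<1+n)
  ... | inj₁ a<n  = same a a<n
  ... | inj₂ refl = ≤-antisym (f≤g n) (≮⇒≥ fn≮gn)

rowLen-≥ : ∀ {n} (w : Vec Bool n) {a} → n ≤ a → rowLen w a ≡ 0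
rowLen-≥ w n≤a = n≤0⇒n≡0 (≮⇒≥ λ 0<r →
  <⇒≱ (Fits-<ˡ (rowLen-antitone w) (rowLen-fits w) 0<r) n≤a)

AddBox⇒⊂ : ∀ {n a} {v w : Vec Bool n} → AddBox a v w → ideal v ⊂ʳ ideal w
AddBox⇒⊂ {a = a} {v} {w} box = from (ideal-⊆⇔ v w) (AddBox-≤ box) , λ eq →
  1+n≢n (trans (sym (at box)) (cong (λ u → rowLen u a) (sym (ideal-injective eq))))

-- Outside row `a` an intermediate diagram is squeezed between equal lengths. In row `a` the lengths
-- differ by one, so it agrees with `v` or with `w`.
AddBox⇒⋖ : ∀ {n a} {v w : Vec Bool n} → AddBox a v w → ideal v ⋖Ab ideal w
AddBox⇒⋖ {a = a} {v} {w} box =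
  ideal-InAb v , ideal-InAb w , AddBox⇒⊂ box , λ z z∈Ab v⊂z z⊂w →
  let u , z≡u = ideal-surjective z z∈Ab in
  nothing-between u (subst (ideal v ⊂ʳ_) z≡u v⊂z) (subst (_⊂ʳ ideal w) z≡u z⊂w)
  where
  nothing-between : ∀ u → ideal v ⊂ʳ ideal u → ¬ (ideal u ⊂ʳ ideal w)
  nothing-between u (v⊆u , v≢u) (u⊆w , u≢w) with m≤n⇒m<n∨m≡n (to (ideal-⊆⇔ v u) v⊆u a)
  ... | inj₂ va≡ua = v≢u (cong ideal (rowLen-injective v u same))
    where
    same : ∀ b → rowLen v b ≡ rowLen u b
    same b with b ≟ a
    ... | yes refl = va≡ua
    ... | no  b≢a  = ≤-antisym (to (ideal-⊆⇔ v u) v⊆u b)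
      (≤-trans (to (ideal-⊆⇔ u w) u⊆w b) (≤-reflexive (elsewhere box b b≢a)))
  ... | inj₁ va<ua = u≢w (cong ideal (rowLen-injective u w same))
    where
    same : ∀ b → rowLen u b ≡ rowLen w b
    same b with b ≟ a
    ... | yes refl = ≤-antisym (to (ideal-⊆⇔ u w) u⊆w a) (≤-trans (≤-reflexive (at box)) va<ua)
    ... | no  b≢a  = ≤-antisym (to (ideal-⊆⇔ u w) u⊆w b)
      (≤-trans (≤-reflexive (elsewhere box b b≢a)) (to (ideal-⊆⇔ v u) v⊆u b))

-- One box is added to `v` at a row where the diagrams differ but the row above agrees. The result
-- `z` stays inside `w`, hence fits, and the covering relation forces it to be `w`.
⋖⇒AddBox : ∀ {n} {v w : Vec Bool n} → ideal v ⋖Ab ideal w → ∃[ a ] AddBox a v w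
⋖⇒AddBox {n} {v} {w} (_ , _ , (v⊆w , v≢w) , nothing-between)
  with first-difference n (to (ideal-⊆⇔ v w) v⊆w)
... | inj₁ same = contradiction (cong ideal (rowLen-injective v w same′)) v≢w
  where
  same′ : ∀ a → rowLen v a ≡ rowLen w a
  same′ a with a <? n
  ... | yes a<n = same a a<n
  ... | no  a≮n = trans (rowLen-≥ v (≮⇒≥ a≮n)) (sym (rowLen-≥ w (≮⇒≥ a≮n)))
... | inj₂ (a , va<wa , same) = a , subst (AddBox a v) z≡w box
  where
  v≤w = to (ideal-⊆⇔ v w) v⊆w
  below : ∀ b → update (rowLen v) a (suc (rowLen v a)) b ≤ rowLen w b
  below b with b ≟ a
  ... | yes refl = va<wa
  ... | no  _    = v≤w b
  added : ∃[ z ] AddBox a v z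
  added = addBox a v
    (update-antitone a (rowLen-antitone v)
      (λ { b refl → ≤-trans va<wa (≤-trans (rowLen-antitone w b) (≤-reflexive (sym (same b refl)))) })
      (m≤n⇒m≤1+n (rowLen-antitone v a)))
    (Fits-antimono below (rowLen-fits w))
  z   = proj₁ added
  box = proj₂ added
  z≤w : ∀ b → rowLen z b ≤ rowLen w b
  z≤w b with b ≟ a
  ... | yes refl = ≤-trans (≤-reflexive (at box)) va<wa
  ... | no  b≢a  = ≤-trans (≤-reflexive (elsewhere box b b≢a)) (v≤w b)
  z≡w : z ≡ w
  z≡w with Vec.≡-dec Bool._≟_ z w
  ... | yes z≡w = z≡w
  ... | no  z≢w = contradiction (from (ideal-⊆⇔ z w) z≤w , z≢w ∘ ideal-injective)
    (nothing-between (ideal z) (ideal-InAb z) (AddBox⇒⊂ box))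

-- Counting covers

RemovedAt AddedAt : ∀ {n} → Vec Bool n → ℕ → RSet n → Set
RemovedAt w a y = ∃[ v ] y ≡ ideal v × AddBox a v w
AddedAt   w a y = ∃[ v ] y ≡ ideal v × AddBox a w v

-- A lower cover is determined by the row that loses a box, so covers correspond to descents.
HasCard-lower-covers : ∀ {n} (w : Vec Bool n) → HasCard (_⋖Ab ideal w) (κ w)
HasCard-lower-covers {n} w = HasCard-transfer (RemovedAt w) image preimage injective functional
  (HasCard-resp-⇔ (λ a → ⇔-sym (removable⇔Descent w a)) (HasCard-Descent w))
  where
  image : ∀ a → (∃[ v ] AddBox a v w) → ∃[ y ] y ⋖Ab ideal w × RemovedAt w a y
  image a (v , box) = ideal v , AddBox⇒⋖ box , v , refl , box
  preimage : ∀ y → y ⋖Ab ideal w → ∃[ a ] (∃[ v ] AddBox a v w) × RemovedAt w a y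
  preimage y y⋖w =
    let v , y≡v = ideal-surjective y (proj₁ y⋖w)
        a , box = ⋖⇒AddBox (subst (_⋖Ab ideal w) y≡v y⋖w)
    in a , (v , box) , v , y≡v , box
  injective : ∀ {a a′ y} → RemovedAt w a y → RemovedAt w a′ y → a ≡ a′
  injective {a′ = a′} (v , eq , box) (v′ , eq′ , box′) = AddBox-injectiveʳ box
    (subst (λ u → AddBox a′ u w) (ideal-injective (trans (sym eq′) eq)) box′)
  functional : ∀ {a y y′} → RemovedAt w a y → RemovedAt w a y′ → y ≡ y′
  functional (v , eq , box) (v′ , eq′ , box′) =
    trans eq (trans (cong ideal (AddBox-functionalˡ box box′)) (sym eq′))

HasCard-upper-covers : ∀ {n} (w : Vec Bool (suc n)) → HasCard (ideal w ⋖Ab_) (ι w)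
HasCard-upper-covers {n} w = HasCard-transfer (AddedAt w) image preimage injective functional
  (HasCard-addable w)
  where
  image : ∀ a → (∃[ v ] AddBox a w v) → ∃[ y ] ideal w ⋖Ab y × AddedAt w a y
  image a (v , box) = ideal v , AddBox⇒⋖ box , v , refl , box
  preimage : ∀ y → ideal w ⋖Ab y → ∃[ a ] (∃[ v ] AddBox a w v) × AddedAt w a y
  preimage y w⋖y =
    let v , y≡v = ideal-surjective y (proj₁ (proj₂ w⋖y))
        a , box = ⋖⇒AddBox (subst (ideal w ⋖Ab_) y≡v w⋖y)
    in a , (v , box) , v , y≡v , box
  injective : ∀ {a a′ y} → AddedAt w a y → AddedAt w a′ y → a ≡ a′
  injective {a′ = a′} (v , eq , box) (v′ , eq′ , box′) = AddBox-injectiveʳ box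
    (subst (AddBox a′ w) (ideal-injective (trans (sym eq′) eq)) box′)
  functional : ∀ {a y y′} → AddedAt w a y → AddedAt w a y′ → y ≡ y′
  functional (v , eq , box) (v′ , eq′ , box′) =
    trans eq (trans (cong ideal (AddBox-functionalʳ box box′)) (sym eq′))

-- Words correspond bijectively to abelian ideals; uniqueness of cardinalities turns having `k`
-- covers into `s w ≡ k`.
HasCard-statistic : ∀ {n k c} {covers : RSet n → RSet n → Set} {s : Vec Bool n → ℕ} →
  (∀ w → HasCard (covers (ideal w)) (s w)) → HasCard (λ w → s w ≡ k) c →
  HasCard (λ x → InAb x × HasCard (covers x) k) c
HasCard-statistic {covers = covers} card = HasCard-transfer (λ w x → x ≡ ideal w)
  (λ w s≡k → ideal w , (ideal-InAb w , subst (HasCard _) s≡k (card w)) , refl)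
  (λ x (x∈Ab , cardₓ) → let w , x≡w = ideal-surjective x x∈Ab in
    w , HasCard-unique (card w) (subst (λ y → HasCard (covers y) _) x≡w cardₓ) , x≡w)
  (λ eq eq′ → ideal-injective (trans (sym eq) eq′))
  (λ eq eq′ → trans eq (sym eq′))

-- The polynomial identity for D

K-difference : ∀ m k → + uRHS (suc m) k ℤ.- + lRHS (suc m) k ≡ mulQm1sq (dRHS m) k
K-difference m = λ
  -- The five numbers are the binomials of `m` with lower indices 2k - 3 to 2k + 1, set to 0 where
  -- the index is negative. Pascal's rule, twice for the upper polynomial and once for the lower,
  -- reduces the claim to `identity`.
  { zero          → combine 0 0 0 (m C 0) (m C 1) refl (pascal m 0) refl
  ; (suc zero)    → combine 0 (m C 0) (m C 1) (m C 2) (m C 3) (pascal² m 0) (pascal m 2) refl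
  ; (suc (suc j)) → large j
  }
  where
  pascal : ∀ n t → suc n C suc t ≡ n C t + n C suc t
  pascal n t = sym (nCk+nC[k+1]≡[n+1]C[k+1] n t)
  pascal² : ∀ n t → suc (suc n) C suc (suc t) ≡
            (n C t + n C suc t) + (n C suc t + n C suc (suc t))
  pascal² n t = trans (pascal (suc n) (suc t)) (cong₂ _+_ (pascal n t) (pascal n (suc t)))
  identity : ∀ a b c d e → ((b ℤ.+ c) ℤ.+ (c ℤ.+ d)) ℤ.- ((d ℤ.+ e) ℤ.+ (a ℤ.+ b)) ≡
             (ℤ.- e) ℤ.- (+ 2) ℤ.* (ℤ.- c) ℤ.+ (ℤ.- a)
  identity = ℤ-Solver.solve-∀
  combine : ∀ {u l₁ l₂} a b c d e → u ≡ (b + c) + (c + d) → l₁ ≡ d + e → l₂ ≡ a + b →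
            + u ℤ.- + (l₁ + l₂) ≡ (ℤ.- + e) ℤ.- (+ 2) ℤ.* (ℤ.- + c) ℤ.+ (ℤ.- + a)
  combine a b c d e refl refl refl = identity (+ a) (+ b) (+ c) (+ d) (+ e)
  large : ∀ j → + uRHS (suc m) (suc (suc j)) ℤ.- + lRHS (suc m) (suc (suc j)) ≡
          mulQm1sq (dRHS m) (suc (suc j))
  large j = combine
    (m C suc (2 * j)) (m C (2 * suc j)) (m C suc (2 * suc j)) (m C (2 * suc (suc j)))
    (m C suc (2 * suc (suc j)))
    (subst (λ i → suc (suc m) C i ≡ (m C (2 * suc j) + m C suc (2 * suc j)) +
                                    (m C suc (2 * suc j) + m C i))
      (sym (*-suc 2 (suc j))) (pascal² m (2 * suc j)))
    (pascal m (2 * suc (suc j)))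
    (subst (λ i → suc m C i ≡ m C suc (2 * j) + m C i)
      (sym (*-suc 2 j)) (pascal m (suc (2 * j))))

theorem5p1 : (m : ℕ) →
    ((k : ℕ) → KuCoeff (suc m) k (uRHS (suc m) k)) ×
    ((k : ℕ) → KlCoeff (suc m) k (lRHS (suc m) k)) ×
    ((u l : ℕ → ℕ) →
    ((k : ℕ) → KuCoeff (suc m) k (u k)) →
    ((k : ℕ) → KlCoeff (suc m) k (l k)) →
    (k : ℕ) → (+ u k) ℤ.- (+ l k) ≡ mulQm1sq (dRHS m) k)
theorem5p1 m = Ku , Kl , λ u l Kᵤ Kₗ k →
  -- Any coefficients `u` and `l` agree with the closed forms, by uniqueness of cardinalities.
  trans (cong₂ (λ a b → + a ℤ.- + b) (HasCard-unique (Kᵤ k) (Ku k)) (HasCard-unique (Kₗ k) (Kl k)))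
        (K-difference m k)
  where
  Ku : ∀ k → KuCoeff (suc m) k (uRHS (suc m) k)
  Ku k = HasCard-statistic HasCard-lower-covers (HasCard-κ (suc m) k)
  Kl : ∀ k → KlCoeff (suc m) k (lRHS (suc m) k)
  Kl k = HasCard-statistic HasCard-upper-covers (HasCard-ι m k)
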